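{- Let $\mathbf L$ be the logic $\mathbf{RmbC}$ or any axiomatic extension of it over the signature $\Sigma$ (i.e. obtained by adding axiom schemas over $\Sigma$), in which derivation from premises is defined as in $\mathbf{RmbC}$. Then $\mathbf L$ satisfies the replacement property: if $\alpha\leftrightarrow\beta$ is a theorem of $\mathbf L$, then $\gamma[p/\alpha]\leftrightarrow\gamma[p/\beta]$ is a theorem of $\mathbf L$, for every formula $\gamma(p)$.
   Context: Let $\Sigma=\{\wedge,\vee,\to,\neg,\circ\}$ ($\neg,\circ$ unary, the others binary) and let $For(\Sigma)$ be the set of formulas over $\Sigma$ generated by a denumerable set $\mathcal V$ of propositional variables. $\alpha\leftrightarrow\beta$ abbreviates $(\alpha\to\beta)\wedge(\beta\to\alpha)$, and $\gamma[p/\alpha]$ denotes the formula obtained from $\gamma$ by replacing every occurrence of the variable $p$ by $\alpha$. $\mathbf{RmbC}$ is the Hilbert calculus with axiom schemas: (Ax1) $\alpha\to(\beta\to\alpha)$; (Ax2) $(\alpha\to(\beta\to\gamma))\to((\alpha\to\beta)\to(\alpha\to\gamma))$; (Ax3) $\alpha\to(\beta\to(\alpha\wedge\beta))$; (Ax4) $(\alpha\wedge\beta)\to\alpha$; (Ax5) $(\alpha\wedge\beta)\to\beta$; (Ax6) $\alpha\to(\alpha\vee\beta)$; (Ax7) $\beta\to(\alpha\vee\beta)$; (Ax8) $(\alpha\to\gamma)\to((\beta\to\gamma)\to((\alpha\vee\beta)\to\gamma))$; (Ax9) $(\alpha\to\beta)\vee\alpha$; (Ax10) $\alpha\vee\neg\alpha$;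 (bc1) $\circ\alpha\to(\alpha\to(\neg\alpha\to\beta))$; and rules: (MP) from $\alpha$ and $\alpha\to\beta$ infer $\beta$; $(\mathbf R_\neg)$ from $\alpha\leftrightarrow\beta$ infer $\neg\alpha\leftrightarrow\neg\beta$; $(\mathbf R_\circ)$ from $\alpha\leftrightarrow\beta$ infer $\circ\alpha\leftrightarrow\circ\beta$. A formula $\varphi$ is a theorem ($\vdash\varphi$) if there is a finite sequence of formulas ending in $\varphi$ each of which is an instance of an axiom schema or follows from earlier formulas of the sequence by a rule. $\Gamma\vdash\varphi$ means that either $\vdash\varphi$ or there is a finite non-empty $\{\gamma_1,\dots,\gamma_n\}\subseteq\Gamma$ with $\vdash(\gamma_1\wedge(\gamma_2\wedge(\cdots\wedge(\gamma_{n-1}\wedge\gamma_n)\cdots)))\to\varphi$. -}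

module Defs where

open import Level using (Level; 0ℓ; _⊔_)
open import Data.Bool.Base using (if_then_else_)
open import Data.List.Base using (List; []; _∷_)
open import Data.List.Membership.Propositional using (_∈_)
open import Data.List.NonEmpty.Base using (List⁺; toList; foldr₁)
open import Data.List.Relation.Unary.All using (All)
open import Data.Nat.Base using (ℕ)
open import Data.Nat.Properties using (_≟_)
open import Data.Product.Base using (∃; _×_)
open import Data.Sum.Base using (_⊎_)
open import Relation.Nullary.Decidable.Core using (does)
open import Relation.Unary using (Pred)

private
  variable
    ℓ ℓ′ : Level

Var : Set
Var = ℕ

infix  9 ¬_ ∘_
infixr 7 _∧_
infixr 6 _∨_
infixr 5 _⇒_
infix  4 _↔_

data Formula : Set where
  var         : Var → Formula
  _∧_ _∨_ _⇒_ : Formula → Formula → Formula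
  ¬_ ∘_       : Formula → Formula

_↔_ : Formula → Formula → Formula
α ↔ β = (α ⇒ β) ∧ (β ⇒ α)

subst : (Var → Formula) → Formula → Formula
subst σ (var q) = σ q
subst σ (α ∧ β) = subst σ α ∧ subst σ β
subst σ (α ∨ β) = subst σ α ∨ subst σ β
subst σ (α ⇒ β) = subst σ α ⇒ subst σ β
subst σ (¬ α)   = ¬ subst σ α
subst σ (∘ α)   = ∘ subst σ α

infix 10 _[_/_]

_[_/_] : Formula → Var → Formula → Formula
γ [ p / α ] = subst (λ q → if does (q ≟ p) then α else var q) γ

data RmbC-Axiom : Pred Formula 0ℓ where
  Ax1  : ∀ α β   → RmbC-Axiom (α ⇒ (β ⇒ α))
  Ax2  : ∀ α β γ → RmbC-Axiom ((α ⇒ (β ⇒ γ)) ⇒ ((α ⇒ β) ⇒ (α ⇒ γ)))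
  Ax3  : ∀ α β   → RmbC-Axiom (α ⇒ (β ⇒ (α ∧ β)))
  Ax4  : ∀ α β   → RmbC-Axiom ((α ∧ β) ⇒ α)
  Ax5  : ∀ α β   → RmbC-Axiom ((α ∧ β) ⇒ β)
  Ax6  : ∀ α β   → RmbC-Axiom (α ⇒ (α ∨ β))
  Ax7  : ∀ α β   → RmbC-Axiom (β ⇒ (α ∨ β))
  Ax8  : ∀ α β γ → RmbC-Axiom ((α ⇒ γ) ⇒ ((β ⇒ γ) ⇒ ((α ∨ β) ⇒ γ)))
  Ax9  : ∀ α β   → RmbC-Axiom ((α ⇒ β) ∨ α)
  Ax10 : ∀ α     → RmbC-Axiom (α ∨ (¬ α))
  bc1  : ∀ α β   → RmbC-Axiom ((∘ α) ⇒ (α ⇒ ((¬ α) ⇒ β)))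

-- An axiomatic extension of RmbC is given by an arbitrary set of additional
-- schemas.  A schema is written as a formula whose variables play the role of
-- metavariables, so its instances are its substitution instances.  The empty
-- set of schemas gives RmbC itself.
Schemas : (ℓ : Level) → Set (Level.suc ℓ)
Schemas ℓ = Pred Formula ℓ

data Axiom (L : Schemas ℓ) : Pred Formula ℓ where
  base  : ∀ {φ} → RmbC-Axiom φ → Axiom L φ
  extra : ∀ {χ} → L χ → (σ : Var → Formula) → Axiom L (subst σ χ)

data Justified (L : Schemas ℓ) (φs : List Formula) : Pred Formula ℓ where
  axiom : ∀ {φ}   → Axiom L φ → Justified L φs φ
  MP    : ∀ {α β} → α ∈ φs → (α ⇒ β) ∈ φs → Justified L φs β
  R¬    : ∀ {α β} → (α ↔ β) ∈ φs → Justified L φs ((¬ α) ↔ (¬ β))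
  R∘    : ∀ {α β} → (α ↔ β) ∈ φs → Justified L φs ((∘ α) ↔ (∘ β))

-- Sequences are listed in reverse: the head is the last formula of the
-- derivation and the tail consists of the formulas preceding it.
data Derivation (L : Schemas ℓ) : Pred (List Formula) ℓ where
  []  : Derivation L []
  _∷_ : ∀ {φ φs} → Justified L φs φ → Derivation L φs → Derivation L (φ ∷ φs)

Theorem : Schemas ℓ → Pred Formula ℓ
Theorem L φ = ∃ λ φs → Derivation L (φ ∷ φs)

-- Derivability from premises.  The rules of inference act on theorems only,
-- never on premises; foldr₁ associates the conjunction to the right.
_∣_⊢_ : Schemas ℓ → Pred Formula ℓ′ → Formula → Set (ℓ ⊔ ℓ′)
L ∣ Γ ⊢ φ =
  Theorem L φ ⊎
  ∃ λ (γs : List⁺ Formula) → All Γ (toList γs) × Theorem L (foldr₁ _∧_ γs ⇒ φ)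

{-# OPTIONS --safe #-}

-- The positive fragment makes ∧, ∨ and ⇒ congruences for provable equivalence,
-- and the rules R¬ and R∘ do so for ¬ and ∘.  Hence substitutions that are
-- pointwise provably equivalent remain so on every formula, by induction on it.
module Submission where

open import Defs
open import Level using (Level)
open import Data.Bool.Base using (true; false)
open import Data.List.Base using (List; []; _∷_; _++_)
open import Data.List.Membership.Propositional.Properties using (∈-++⁺ʳ)
open import Data.List.Relation.Binary.Subset.Propositional using (_⊆_)
open import Data.List.Relation.Binary.Subset.Propositional.Properties using (xs⊆xs++ys)
open import Data.List.Relation.Unary.Any using (here; there)
open import Data.Nat.Properties using (_≟_)
open import Data.Product.Base using (_,_)
open import Relation.Binary.PropositionalEquality using (refl)
open import Relation.Nullary.Decidable.Core using (does)

module _ {ℓ : Level} {L : Schemas ℓ} where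

  private
    variable
      α β γ α′ β′ χ : Formula
      φs ψs : List Formula

  -- A step refers to earlier formulas only through membership, so it stays justified when more
  -- formulas precede it.
  Justified-mono : φs ⊆ ψs → Justified L φs χ → Justified L ψs χ
  Justified-mono s (axiom a) = axiom a
  Justified-mono s (MP i j)  = MP (s i) (s j)
  Justified-mono s (R¬ i)    = R¬ (s i)
  Justified-mono s (R∘ i)    = R∘ (s i)

  -- Lists run backwards, so `ψs` is the earlier block: its steps are kept as they are, while each
  -- step of `φs` gains `ψs` among its predecessors.
  Derivation-++ : Derivation L φs → Derivation L ψs → Derivation L (φs ++ ψs)
  Derivation-++ []      e = e
  Derivation-++ (j ∷ d) e = Justified-mono (xs⊆xs++ys _ _) j ∷ Derivation-++ d e

  ax : RmbC-Axiom χ → Theorem L χ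
  ax a = [] , axiom (base a) ∷ []

  mp : Theorem L (α ⇒ β) → Theorem L α → Theorem L β
  mp {α} {β} (φs , d) (ψs , e) =
    -- The implication heads the joined list; `α` is the head of the second block, behind the whole
    -- derivation of `α ⇒ β`.
    _ , MP (∈-++⁺ʳ ((α ⇒ β) ∷ φs) (here refl)) (here refl) ∷ Derivation-++ d e

  ¬-cong : Theorem L (α ↔ β) → Theorem L (¬ α ↔ ¬ β)
  ¬-cong (_ , d) = _ , R¬ (here refl) ∷ d

  ∘-cong : Theorem L (α ↔ β) → Theorem L (∘ α ↔ ∘ β)
  ∘-cong (_ , d) = _ , R∘ (here refl) ∷ d

  ⇒-const : Theorem L β → Theorem L (α ⇒ β)
  ⇒-const = mp (ax (Ax1 _ _))

  -- Modus ponens under a common antecedent `χ`. Together with `⇒-const` it does the work of a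
  -- deduction theorem below.
  ⇒-ap : Theorem L (χ ⇒ α ⇒ β) → Theorem L (χ ⇒ α) → Theorem L (χ ⇒ β)
  ⇒-ap p q = mp (mp (ax (Ax2 _ _ _)) p) q

  ⇒-trans : Theorem L (α ⇒ β) → Theorem L (β ⇒ γ) → Theorem L (α ⇒ γ)
  ⇒-trans p q = ⇒-ap (⇒-const q) p

  ⇒-refl : Theorem L (α ⇒ α)
  -- The combinator identity I = S K K, with `α ⇒ α` as the intermediate formula.
  ⇒-refl {α} = ⇒-ap (ax (Ax1 α (α ⇒ α))) (ax (Ax1 α α))

  ↔-intro : Theorem L (α ⇒ β) → Theorem L (β ⇒ α) → Theorem L (α ↔ β)
  ↔-intro p q = mp (mp (ax (Ax3 _ _)) p) q

  ↔-to : Theorem L (α ↔ β) → Theorem L (α ⇒ β)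
  ↔-to = mp (ax (Ax4 _ _))

  ↔-from : Theorem L (α ↔ β) → Theorem L (β ⇒ α)
  ↔-from = mp (ax (Ax5 _ _))

  ↔-refl : Theorem L (α ↔ α)
  ↔-refl = ↔-intro ⇒-refl ⇒-refl

  ∧-mono : Theorem L (α ⇒ α′) → Theorem L (β ⇒ β′) → Theorem L (α ∧ β ⇒ α′ ∧ β′)
  ∧-mono p q = ⇒-ap (⇒-trans (⇒-trans (ax (Ax4 _ _)) p) (ax (Ax3 _ _)))
                    (⇒-trans (ax (Ax5 _ _)) q)

  ∨-mono : Theorem L (α ⇒ α′) → Theorem L (β ⇒ β′) → Theorem L (α ∨ β ⇒ α′ ∨ β′)
  ∨-mono p q = mp (mp (ax (Ax8 _ _ _)) (⇒-trans p (ax (Ax6 _ _))))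
                  (⇒-trans q (ax (Ax7 _ _)))

  ⇒-mono : Theorem L (α′ ⇒ α) → Theorem L (β ⇒ β′) → Theorem L ((α ⇒ β) ⇒ (α′ ⇒ β′))
  ⇒-mono p q = ⇒-trans
    -- Precomposition with `p` gives `(α ⇒ β) ⇒ (α′ ⇒ β)`; postcomposition with `q` then turns `β`
    -- into `β′`.
    (⇒-ap (⇒-trans (ax (Ax1 _ _)) (ax (Ax2 _ _ _))) (⇒-const p))
    (mp (ax (Ax2 _ _ _)) (⇒-const q))

  ∧-cong : Theorem L (α ↔ α′) → Theorem L (β ↔ β′) → Theorem L (α ∧ β ↔ α′ ∧ β′)
  ∧-cong p q = ↔-intro (∧-mono (↔-to p) (↔-to q)) (∧-mono (↔-from p) (↔-from q))

  ∨-cong : Theorem L (α ↔ α′) → Theorem L (β ↔ β′) → Theorem L (α ∨ β ↔ α′ ∨ β′)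
  ∨-cong p q = ↔-intro (∨-mono (↔-to p) (↔-to q)) (∨-mono (↔-from p) (↔-from q))

  ⇒-cong : Theorem L (α ↔ α′) → Theorem L (β ↔ β′) → Theorem L ((α ⇒ β) ↔ (α′ ⇒ β′))
  ⇒-cong p q = ↔-intro (⇒-mono (↔-from p) (↔-to q)) (⇒-mono (↔-to p) (↔-from q))

  -- With two arbitrary substitutions the variable case is the hypothesis itself, and the comparison
  -- of variables stays out of the induction.
  subst-cong : {σ τ : Var → Formula} → (∀ q → Theorem L (σ q ↔ τ q)) →
               ∀ γ → Theorem L (subst σ γ ↔ subst τ γ)
  subst-cong h (var q) = h q
  subst-cong h (γ ∧ δ) = ∧-cong (subst-cong h γ) (subst-cong h δ)
  subst-cong h (γ ∨ δ) = ∨-cong (subst-cong h γ) (subst-cong h δ)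
  subst-cong h (γ ⇒ δ) = ⇒-cong (subst-cong h γ) (subst-cong h δ)
  subst-cong h (¬ γ)   = ¬-cong (subst-cong h γ)
  subst-cong h (∘ γ)   = ∘-cong (subst-cong h γ)

theorem2p8 : ∀ {ℓ : Level} (L : Schemas ℓ) (α β : Formula) →
    Theorem L (α ↔ β) →
    ∀ (γ : Formula) (p : Var) → Theorem L ((γ [ p / α ]) ↔ (γ [ p / β ]))
theorem2p8 L α β α↔β γ p = subst-cong pointwise γ
  where
  pointwise : ∀ q → Theorem L (var q [ p / α ] ↔ var q [ p / β ])
  -- Abstracting the test reduces both conditionals at once: to `α` and `β` at `p`, and to `var q`
  -- on both sides elsewhere.
  pointwise q with does (q ≟ p)
  ... | true  = α↔β
  ... | false = ↔-refl
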